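{- Let $\mathbb{F}$ be a field of characteristic zero and let $g(x) = g_0 + g_r x^r + g_{r+1}x^{r+1} + \cdots \in \mathbb{F}[[x]]$ with $g_0 = \pm 1$, $r \ge 1$ odd, and $g_r \neq 0$. Write $g(x) = g_0 + g_r\cdot \big(G(x)\big)^r$ with $G(x) = x + \cdots$, where $$G(x) = x\cdot\left(1 + \frac{g_{r+1}}{g_r}x + \frac{g_{r+2}}{g_r}x^2 + \cdots\right)^{1/r}.$$ Then there exists a unique $F(x) = f_1x + f_2x^2 + \cdots \in \mathbb{F}[[x]]$ with $f_1 \neq 0$ such that $\big(g(x), F(x)\big)$ is an involution in the Riordan group $\mathcal{R}(\mathbb{F})$. It is given by $$F(x) = \overline{G}\left(\frac{ -G(x)}{\big(g_0\, g(x)\big)^{1/r}}\right).$$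
   Context: The Riordan group $\mathcal{R}(\mathbb{F})$ consists of the pairs $\big(g(x),F(x)\big)$ of formal power series over $\mathbb{F}$ with $g(x) = g_0 + g_1x + \cdots$, $g_0 \neq 0$, and $F(x) = f_1x + f_2x^2 + \cdots$, $f_1 \neq 0$ (identified with the infinite lower triangular matrix whose $(m,n)$ entry, $m,n\ge 0$, is the coefficient of $x^m$ in $g(x)F(x)^n$). Multiplication is $\big(g(x),F(x)\big)\cdot\big(h(x),K(x)\big) = \big(g(x)\cdot h(F(x)),\, K(F(x))\big)$, and the identity is $(1,x)$. An involution is an element of order exactly two; so $(g,F)\neq(1,x)$ is an involution iff $g(x)\cdot g(F(x)) = 1$ and $F(F(x)) = x$. For $a(x)\in\mathbb{F}[[x]]$ with constant term $1$ and $n$ a positive integer, $a(x)^{1/n}$ denotes the unique series with constant term $1$ whose $n$-th power is $a(x)$. For a series $G(x)$ with zero constant term and nonzero coefficient of $x$, $\overline{G}(x)$ denotes its compositional inverse. -}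

module Defs where

open import Level using (Level; _⊔_)
open import Data.Nat.Base as ℕ using (ℕ; zero; suc; _∸_)
open import Data.Fin.Base using (toℕ)
open import Data.Product.Base using (_×_; _,_; proj₁; proj₂)
open import Relation.Nullary.Negation using (¬_)
open import Algebra.Bundles using (CommutativeRing; RawRing; Semiring)
open import Algebra.Apartness.Bundles using (HeytingCommutativeRing; HeytingField)
import Algebra.Definitions.RawSemiring as RawSemiringDefs

-- Fields are Heyting fields, and the apartness x # y plays the role of "x ≠ y"
-- for scalars.  Classically (or over any field with decidable equality) _#_ is
-- just the negation of _≈_, so every classical field is an instance.
module PowerSeries {c ℓ₁ ℓ₂ : Level} (𝔽 : HeytingField c ℓ₁ ℓ₂) where

  private
    module K = CommutativeRing
      (HeytingCommutativeRing.commutativeRing (HeytingField.heytingCommutativeRing 𝔽))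
  open HeytingField 𝔽
  open RawSemiringDefs (Semiring.rawSemiring K.semiring) using (sum) renaming (_×_ to _·ℕ_)

  CharacteristicZero : Set ℓ₂
  CharacteristicZero = ∀ n → (suc n ·ℕ 1#) # 0#

  -- #⇒invertible provides an inverse of x - 0#, which is ≈ x.
  inv : ∀ {x} → x # 0# → Carrier
  inv x#0 = proj₁ (#⇒invertible x#0)

  infix  4 _≋_
  infixl 6 _⊕_
  infixl 7 _⊛_
  infix  8 ⊖_
  infixr 7 _•_
  infixr 9 _⊚_

  Series : Set c
  Series = ℕ → Carrier

  _≋_ : Series → Series → Set ℓ₁
  f ≋ g = ∀ n → f n ≈ g n

  C : Carrier → Series
  C a zero    = a
  C a (suc _) = 0#

  X : Series
  X zero          = 0#
  X (suc zero)    = 1#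
  X (suc (suc _)) = 0#

  _⊕_ : Series → Series → Series
  (f ⊕ g) n = f n + g n

  ⊖_ : Series → Series
  (⊖ f) n = - f n

  _•_ : Carrier → Series → Series
  (a • f) n = a * f n

  _⊛_ : Series → Series → Series
  (f ⊛ g) n = sum {suc n} (λ i → f (toℕ i) * g (n ∸ toℕ i))

  seriesRawRing : RawRing c ℓ₁
  seriesRawRing = record
    { Carrier = Series ; _≈_ = _≋_ ; _+_ = _⊕_ ; _*_ = _⊛_ ; -_ = ⊖_
    ; 0# = C 0# ; 1# = C 1# }

  open RawSemiringDefs (RawRing.rawSemiring seriesRawRing) using (_^_) public

  -- h ⊚ f is h(f(x)), meaningful only when f has zero constant term: then f ^ n
  -- has order at least n, so only the powers n ≤ m contribute to the
  -- coefficient of x^m.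
  _⊚_ : Series → Series → Series
  (h ⊚ f) m = sum {suc m} (λ n → h (toℕ n) * (f ^ toℕ n) m)

  -- b = a^{1/n}
  record IsRoot (n : ℕ) (a b : Series) : Set (c ⊔ ℓ₁) where
    field
      constant : b 0 ≈ 1#
      power    : b ^ n ≋ a
      unique   : ∀ b′ → b′ 0 ≈ 1# → b′ ^ n ≋ a → b′ ≋ b

  record IsReciprocal (a b : Series) : Set ℓ₁ where
    field
      product : a ⊛ b ≋ C 1#

  record IsCompositionalInverse (G H : Series) : Set ℓ₁ where
    field
      constant : H 0 ≈ 0#
      inverseʳ : G ⊚ H ≋ X
      inverseˡ : H ⊚ G ≋ X

  Pair : Set c
  Pair = Series × Series

  infix  4 _≋ᴾ_
  infixl 7 _∙_

  _≋ᴾ_ : Pair → Pair → Set ℓ₁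
  (g , F) ≋ᴾ (h , K) = (g ≋ h) × (F ≋ K)

  record IsRiordan (p : Pair) : Set (ℓ₁ ⊔ ℓ₂) where
    private
      g = proj₁ p
      F = proj₂ p
    field
      g₀#0 : g 0 # 0#
      F₀≈0 : F 0 ≈ 0#
      F₁#0 : F 1 # 0#

  _∙_ : Pair → Pair → Pair
  (g , F) ∙ (h , K) = (g ⊛ (h ⊚ F)) , (K ⊚ F)

  identity : Pair
  identity = C 1# , X

  record IsInvolution (p : Pair) : Set (ℓ₁ ⊔ ℓ₂) where
    field
      isRiordan  : IsRiordan p
      square     : p ∙ p ≋ᴾ identity
      nontrivial : ¬ (p ≋ᴾ identity)

  -- 1 + (g_{r+1}/g_r) x + (g_{r+2}/g_r) x² + ⋯
  normalisedTail : (g : Series) (r : ℕ) → g r # 0# → Series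
  normalisedTail g r gᵣ#0 zero    = 1#
  normalisedTail g r gᵣ#0 (suc k) = g (suc k ℕ.+ r) * inv gᵣ#0

{-# OPTIONS --safe #-}
module Submission where

open import Level using (Level)
open import Data.Nat.Base using (ℕ; zero; suc; _%_; _≤_; _<_; s≤s; z≤n)
import Data.Nat.Base as ℕ
import Data.Nat.Properties as ℕ
open import Data.Nat.DivMod using (m≡m%n+[m/n]*n)
open import Data.Fin.Base using (toℕ)
open import Data.Product using (_×_; _,_; ∃; ∃!; proj₁; proj₂)
open import Data.Sum.Base using (_⊎_; inj₁; inj₂)
open import Relation.Binary.PropositionalEquality.Core as ≡ using (_≡_)
open import Algebra.Bundles using (CommutativeRing; Semiring)
open import Algebra.Apartness.Bundles using (HeytingCommutativeRing; HeytingField)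
import Algebra.Definitions.RawSemiring as RawSemiringDefinitions
import Algebra.Properties.CommutativeSemiring.Exp
import Algebra.Properties.Monoid.Sum
import Algebra.Properties.Ring
import Algebra.Solver.Ring.NaturalCoefficients.Default
import Relation.Binary.Reasoning.Setoid as SetoidReasoning
open import Defs

-- Write ε = g₀, τ = (ε g)^{-1/r} and V = -G τ, so that F = Ḡ ∘ V means G ∘ F = V.  Since
-- g = ε + gᵣ Gʳ and r is odd, g ∘ F = ε + gᵣ Vʳ = ε - (g - ε) / (ε g) = 1 / g.  Hence
-- τ ∘ F = 1 / τ, so G ∘ F ∘ F = -(G ∘ F) / τ = G and F ∘ F = x.
-- Conversely, if K gives an involution, then g ∘ K = 1 / g forces (G ∘ K)ʳ = Vʳ.  The linear
-- coefficients of both series square to 1, so, r being odd, they agree, and unique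
-- extraction of r-th roots yields G ∘ K = V.

-- Root extraction is unique only among series with constant term 1, whereas `G ∘ K` and `V` have
-- constant term 0. Both are therefore rewritten as `X` times a cofactor: `gᵣ` and the power of `X`
-- cancel, and the cofactors are compared, up to a sign that an odd power carries along. Equality of
-- scalars need not be decidable, so no step chooses between `K₁ = 1` and `K₁ = -1`: the relation
-- `K₁² = 1` is read off `K ∘ K = x`, and oddness of r turns it into `K₁ʳ = K₁`. Reciprocals and
-- compositional inverses come from one principle: an operator on series whose output modulo
-- `x^(n+1)` depends only on its input modulo `x^n` has a fixed point. Roots are then read off a
-- compositional inverse, and characteristic zero makes the linear coefficient r of `(1 + x)^r - 1`
-- invertible.

odd⇒suc-double : ∀ r → r % 2 ≡ 1 → ∃ λ k → r ≡ suc (k ℕ.* 2)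
odd⇒suc-double r r%2≡1 =
  r ℕ./ 2 , ≡.trans (m≡m%n+[m/n]*n r 2) (≡.cong (ℕ._+ (r ℕ./ 2) ℕ.* 2) r%2≡1)

-- The commutative ring of formal power series.

module SeriesRing {c ℓ₁ ℓ₂ : Level} (𝔽 : HeytingField c ℓ₁ ℓ₂) where
  open HeytingField 𝔽
  open PowerSeries 𝔽

  fieldRing : CommutativeRing c ℓ₁
  fieldRing = HeytingCommutativeRing.commutativeRing heytingCommutativeRing

  module 𝕂 = CommutativeRing fieldRing
  open Algebra.Solver.Ring.NaturalCoefficients.Default 𝕂.commutativeSemiring
    using (solve; _:=_; _:+_; _:*_; con)

  tail : Series → Series
  tail f n = f (suc n)

  -- Congruence modulo `x^n`, the precision in which composition and fixed points are controlled.
  Agree : ℕ → Series → Series → Set ℓ₁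
  Agree n f g = ∀ i → i < n → f i ≈ g i

  agree-weaken : ∀ {m n f g} → m ≤ n → Agree n f g → Agree m f g
  agree-weaken m≤n p i i<m = p i (ℕ.≤-trans i<m m≤n)

  ≋⇒agree : ∀ {f g} n → f ≋ g → Agree n f g
  ≋⇒agree n p i _ = p i

  ⊛-cong-at : ∀ m {f f′ g g′} → Agree (suc m) f f′ → Agree (suc m) g g′ →
              (f ⊛ g) m ≈ (f′ ⊛ g′) m
  ⊛-cong-at zero p q = +-congʳ (*-cong (p 0 (s≤s z≤n)) (q 0 (s≤s z≤n)))
  ⊛-cong-at (suc m) p q =
    +-cong (*-cong (p 0 (s≤s z≤n)) (q (suc m) ℕ.≤-refl))
           (⊛-cong-at m (λ i i<m → p (suc i) (s≤s i<m)) (agree-weaken (ℕ.n≤1+n _) q))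

  ⊛-agree : ∀ n {f f′ g g′} → Agree n f f′ → Agree n g g′ → Agree n (f ⊛ g) (f′ ⊛ g′)
  ⊛-agree n p q i i<n = ⊛-cong-at i (agree-weaken i<n p) (agree-weaken i<n q)

  ⊛-cong : ∀ {f f′ g g′} → f ≋ f′ → g ≋ g′ → f ⊛ g ≋ f′ ⊛ g′
  ⊛-cong p q m = ⊛-cong-at m (≋⇒agree _ p) (≋⇒agree _ q)

  -- The convolution sum unfolds from its first term, on the side of `f`. Peeling off the last term
  -- is the mirror image that lets commutativity go by induction.
  ⊛-last : ∀ f g m → (f ⊛ g) (suc m) ≈ f (suc m) * g 0 + (f ⊛ tail g) m
  ⊛-last f g zero =
    solve 4 (λ a b c d → a :* d :+ (b :* c :+ con 0) := b :* c :+ (a :* d :+ con 0))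
      refl (f 0) (f 1) (g 0) (g 1)
  ⊛-last f g (suc m) =
    trans (+-congˡ (⊛-last (tail f) g m))
      (solve 3 (λ a b c → a :+ (b :+ c) := b :+ (a :+ c)) refl _ _ _)

  ⊛-comm : ∀ f g → f ⊛ g ≋ g ⊛ f
  ⊛-comm f g zero    = +-congʳ (*-comm _ _)
  ⊛-comm f g (suc m) =
    trans (+-cong (*-comm _ _) (⊛-comm (tail f) g m)) (sym (⊛-last g f m))

  ⊛-distribʳ : ∀ h f g → (f ⊕ g) ⊛ h ≋ f ⊛ h ⊕ g ⊛ h
  ⊛-distribʳ h f g zero =
    solve 3 (λ a b c → (a :+ b) :* c :+ con 0 := (a :* c :+ con 0) :+ (b :* c :+ con 0))
      refl (f 0) (g 0) (h 0)
  ⊛-distribʳ h f g (suc m) =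
    trans (+-congˡ (⊛-distribʳ h (tail f) (tail g) m))
      (solve 5 (λ a b c d e → (a :+ b) :* c :+ (d :+ e) := (a :* c :+ d) :+ (b :* c :+ e))
        refl (f 0) (g 0) (h (suc m)) _ _)

  ⊛-distribˡ : ∀ h f g → h ⊛ (f ⊕ g) ≋ h ⊛ f ⊕ h ⊛ g
  ⊛-distribˡ h f g m =
    trans (⊛-comm h (f ⊕ g) m)
      (trans (⊛-distribʳ h f g m) (+-cong (⊛-comm f h m) (⊛-comm g h m)))

  •-⊛ : ∀ a f g → (a • f) ⊛ g ≋ a • (f ⊛ g)
  •-⊛ a f g zero =
    solve 3 (λ a b c → (a :* b) :* c :+ con 0 := a :* (b :* c :+ con 0)) refl a (f 0) (g 0)
  •-⊛ a f g (suc m) =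
    trans (+-congˡ (•-⊛ a (tail f) g m))
      (solve 4 (λ a b c d → (a :* b) :* c :+ a :* d := a :* (b :* c :+ d))
        refl a (f 0) (g (suc m)) _)

  ⊛-• : ∀ a f g → f ⊛ (a • g) ≋ a • (f ⊛ g)
  ⊛-• a f g m =
    trans (⊛-comm f (a • g) m) (trans (•-⊛ a g f m) (*-congˡ (⊛-comm g f m)))

  ⊛-assoc : ∀ f g h → (f ⊛ g) ⊛ h ≋ f ⊛ (g ⊛ h)
  ⊛-assoc f g h zero =
    solve 3 (λ a b c → (a :* b :+ con 0) :* c :+ con 0 := a :* (b :* c :+ con 0) :+ con 0)
      refl (f 0) (g 0) (h 0)
  ⊛-assoc f g h (suc m) =
    trans (+-congˡ (trans (⊛-distribʳ h (f 0 • tail g) (tail f ⊛ g) m)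
                     (+-cong (•-⊛ (f 0) (tail g) h m) (⊛-assoc (tail f) g h m))))
      (solve 5 (λ a b c d e → (a :* b :+ con 0) :* c :+ (a :* d :+ e)
                               := a :* (b :* c :+ d) :+ e)
        refl (f 0) (g 0) (h (suc m)) _ _)

  C0≈0 : ∀ m → C 0# m ≈ 0#
  C0≈0 zero    = refl
  C0≈0 (suc _) = refl

  C-positive : ∀ a {n} → 1 ≤ n → C a n ≈ 0#
  C-positive a (s≤s _) = refl

  C-+ : ∀ a b → C (a + b) ≋ C a ⊕ C b
  C-+ a b zero    = refl
  C-+ a b (suc _) = sym (+-identityʳ 0#)

  C-* : ∀ a b → C (a * b) ≋ a • C b
  C-* a b zero    = refl
  C-* a b (suc _) = sym (zeroʳ a)

  C-cong : ∀ {a b} → a ≈ b → C a ≋ C b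
  C-cong a≈b zero    = a≈b
  C-cong a≈b (suc _) = refl

  ⊛-zeroˡ : ∀ {z} g → (∀ n → z n ≈ 0#) → ∀ m → (z ⊛ g) m ≈ 0#
  ⊛-zeroˡ g z≈0 zero    = trans (+-identityʳ _) (trans (*-congʳ (z≈0 0)) (zeroˡ _))
  ⊛-zeroˡ g z≈0 (suc m) =
    trans (+-cong (trans (*-congʳ (z≈0 0)) (zeroˡ _)) (⊛-zeroˡ g (λ n → z≈0 (suc n)) m))
          (+-identityʳ 0#)

  C-⊛ : ∀ a f → C a ⊛ f ≋ a • f
  C-⊛ a f zero    = +-identityʳ _
  C-⊛ a f (suc m) = trans (+-congˡ (⊛-zeroˡ f (λ _ → refl) m)) (+-identityʳ _)

  1⊛ : ∀ f → C 1# ⊛ f ≋ f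
  1⊛ f m = trans (C-⊛ 1# f m) (*-identityˡ _)

  seriesRing : CommutativeRing c ℓ₁
  seriesRing = record
    { Carrier = Series ; _≈_ = _≋_ ; _+_ = _⊕_ ; _*_ = _⊛_ ; -_ = ⊖_ ; 0# = C 0# ; 1# = C 1#
    ; isCommutativeRing = record
      { isRing = record
        { +-isAbelianGroup = record
          { isGroup = record
            { isMonoid = record
              { isSemigroup = record
                { isMagma = record
                  { isEquivalence = record
                    { refl  = λ _ → refl
                    ; sym   = λ p m → sym (p m)
                    ; trans = λ p q m → trans (p m) (q m)
                    }
                  ; ∙-cong = λ p q m → +-cong (p m) (q m)
                  }
                ; assoc = λ f g h m → +-assoc (f m) (g m) (h m)
                }
              ; identity = (λ f m → trans (+-congʳ (C0≈0 m)) (+-identityˡ (f m)))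
                         , (λ f m → trans (+-congˡ (C0≈0 m)) (+-identityʳ (f m)))
              }
            ; inverse = (λ f m → trans (-‿inverseˡ (f m)) (sym (C0≈0 m)))
                      , (λ f m → trans (-‿inverseʳ (f m)) (sym (C0≈0 m)))
            ; ⁻¹-cong = λ p m → -‿cong (p m)
            }
          ; comm = λ f g m → +-comm (f m) (g m)
          }
        ; *-cong     = ⊛-cong
        ; *-assoc    = ⊛-assoc
        ; *-identity = 1⊛ , λ f m → trans (⊛-comm f (C 1#) m) (1⊛ f m)
        ; distrib    = ⊛-distribˡ , ⊛-distribʳ
        }
      ; *-comm = ⊛-comm
      }
    }

  module 𝕊 = CommutativeRing seriesRing
  module 𝕊^ = Algebra.Properties.CommutativeSemiring.Exp 𝕊.commutativeSemiring

  ^-cong : ∀ n {f g} → f ≋ g → f ^ n ≋ g ^ n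
  ^-cong = 𝕊^.^-congˡ

  1^ : ∀ n → C 1# ^ n ≋ C 1#
  1^ zero    _ = refl
  1^ (suc n)   = 𝕊.trans (1⊛ (C 1# ^ n)) (1^ n)

  suc-⊛ : ∀ f g → f 0 ≈ 0# → ∀ m → (f ⊛ g) (suc m) ≈ (tail f ⊛ g) m
  suc-⊛ f g f₀≈0 m = trans (+-congʳ (trans (*-congʳ f₀≈0) (zeroˡ _))) (+-identityˡ _)

  zero-⊛ : ∀ f g → f 0 ≈ 0# → (f ⊛ g) 0 ≈ 0#
  zero-⊛ f g f₀≈0 = trans (+-identityʳ _) (trans (*-congʳ f₀≈0) (zeroˡ _))

  -- A factor without constant term gains one order of precision. This gain drives both the Horner
  -- recursion for `⊚` and every contraction.
  ⊛-agree-suc : ∀ f g h → f 0 ≈ 0# → ∀ n → Agree n g h → Agree (suc n) (f ⊛ g) (f ⊛ h)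
  ⊛-agree-suc f g h f₀≈0 n p zero    _         =
    trans (zero-⊛ f g f₀≈0) (sym (zero-⊛ f h f₀≈0))
  ⊛-agree-suc f g h f₀≈0 n p (suc i) (s≤s i<n) =
    trans (suc-⊛ f g f₀≈0 i)
      (trans (⊛-agree n {tail f} (λ _ _ → refl) p i i<n) (sym (suc-⊛ f h f₀≈0 i)))

  tail-X : tail X ≋ C 1#
  tail-X zero    = refl
  tail-X (suc _) = refl

  suc-X⊛ : ∀ f m → (X ⊛ f) (suc m) ≈ f m
  suc-X⊛ f m = trans (suc-⊛ X f refl m) (trans (⊛-cong tail-X (𝕊.refl {f}) m) (1⊛ f m))

  X⊛-tail : ∀ f → f 0 ≈ 0# → f ≋ X ⊛ tail f
  X⊛-tail f f₀≈0 zero    = trans f₀≈0 (sym (zero-⊛ X (tail f) refl))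
  X⊛-tail f f₀≈0 (suc m) = sym (suc-X⊛ (tail f) m)

  decompose : ∀ f → f ≋ C (f 0) ⊕ X ⊛ tail f
  decompose f zero    = sym (trans (+-congˡ (zero-⊛ X (tail f) refl)) (+-identityʳ _))
  decompose f (suc m) = sym (trans (+-identityˡ _) (suc-X⊛ (tail f) m))

  X^-low : ∀ n f i → i < n → (X ^ n ⊛ f) i ≈ 0#
  X^-low (suc n) f zero    _         =
    trans (⊛-assoc X (X ^ n) f 0) (zero-⊛ X (X ^ n ⊛ f) refl)
  X^-low (suc n) f (suc i) (s≤s i<n) =
    trans (⊛-assoc X (X ^ n) f (suc i)) (trans (suc-X⊛ (X ^ n ⊛ f) i) (X^-low n f i i<n))

  X^-shift : ∀ n f i → (X ^ n ⊛ f) (n ℕ.+ i) ≈ f i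
  X^-shift zero    f i = 1⊛ f i
  X^-shift (suc n) f i =
    trans (⊛-assoc X (X ^ n) f (suc (n ℕ.+ i)))
      (trans (suc-X⊛ (X ^ n ⊛ f) (n ℕ.+ i)) (X^-shift n f i))

  X^-cancel : ∀ n p q → X ^ n ⊛ p ≋ X ^ n ⊛ q → p ≋ q
  X^-cancel n p q eq i = trans (sym (X^-shift n p i)) (trans (eq (n ℕ.+ i)) (X^-shift n q i))

-- Composition of power series and its algebraic laws.

module Composition {c ℓ₁ ℓ₂ : Level} (𝔽 : HeytingField c ℓ₁ ℓ₂) where
  open HeytingField 𝔽
  open PowerSeries 𝔽
  open SeriesRing 𝔽
  open RawSemiringDefinitions (Semiring.rawSemiring 𝕂.semiring) using (sum)
  open Algebra.Properties.Monoid.Sum 𝕂.+-monoid using (sum-cong-≋)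
  open Algebra.Solver.Ring.NaturalCoefficients.Default 𝕂.commutativeSemiring
    using (solve; _:=_; _:+_; _:*_)

  open Algebra.Solver.Ring.NaturalCoefficients.Default 𝕊.commutativeSemiring
    using () renaming (solve to solve𝕊; _:=_ to _≐_; _:+_ to _⊞_; _:*_ to _⊠_)

  combination : ℕ → Series → (ℕ → Series) → Series
  combination N h p m = sum {N} (λ n → h (toℕ n) * p (toℕ n) m)

  ⊛-combination : ∀ N f h p → f ⊛ combination N h p ≋ combination N h (λ n → f ⊛ p n)
  ⊛-combination zero    f h p m =
    trans (⊛-comm f (λ _ → 0#) m) (⊛-zeroˡ {λ _ → 0#} f (λ _ → refl) m)
  ⊛-combination (suc N) f h p =
    𝕊.trans (⊛-distribˡ f (h 0 • p 0) (combination N (tail h) (λ n → p (suc n))))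
      (𝕊.+-cong (𝕊.trans (⊛-comm f (h 0 • p 0)) (𝕊.trans (•-⊛ (h 0) (p 0) f)
                   (λ m → *-congˡ (⊛-comm (p 0) f m))))
                (⊛-combination N f (tail h) (λ n → p (suc n))))

  -- In `h ⊚ f` the cut-off depends on the coefficient being read. Here it is a fixed `N`, so the
  -- truncated composite is a genuine finite sum in the series ring.
  partial : ℕ → Series → Series → Series
  partial N h f = combination N h (f ^_)

  partial-suc : ∀ N h f → partial (suc N) h f ≋ C (h 0) ⊕ f ⊛ partial N (tail h) f
  partial-suc N h f =
    𝕊.+-cong (𝕊.trans (𝕊.sym (C-⊛ (h 0) (C 1#))) (𝕊.*-identityʳ (C (h 0))))
             (𝕊.sym (⊛-combination N f (tail h) (f ^_)))

  partial-stable : ∀ f → f 0 ≈ 0# → ∀ N h → Agree N (partial N h f) (partial (suc N) h f)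
  partial-stable f f₀≈0 zero    h i ()
  partial-stable f f₀≈0 (suc N) h i i<N =
    trans (partial-suc N h f i)
      (trans (+-congˡ (⊛-agree-suc f (partial N (tail h) f) (partial (suc N) (tail h) f) f₀≈0 N
                        (partial-stable f f₀≈0 N (tail h)) i i<N))
             (sym (partial-suc (suc N) h f i)))

  ⊚-partial : ∀ f → f 0 ≈ 0# → ∀ N h → Agree N (h ⊚ f) (partial N h f)
  ⊚-partial f f₀≈0 N h i i<N = go (ℕ.≤⇒≤′ i<N)
    where
    go : ∀ {N} → i ℕ.<′ N → (h ⊚ f) i ≈ partial N h f i
    -- At coefficient `i` the composite is by definition the sum cut off at `suc i`; larger cut-offs
    -- are reached one at a time.
    go ℕ.<′-base      = refl
    go (ℕ.≤′-step lt) = trans (go lt) (partial-stable f f₀≈0 _ h i (ℕ.≤′⇒≤ lt))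

  -- At coefficient m, peeling one term off the sum leaves `tail h` cut off at m, one term short of
  -- the composite. The zero constant term of `f` absorbs the difference.
  ⊚-horner : ∀ f → f 0 ≈ 0# → ∀ h → h ⊚ f ≋ C (h 0) ⊕ f ⊛ (tail h ⊚ f)
  ⊚-horner f f₀≈0 h m =
    trans (partial-suc m h f m)
      (sym (+-congˡ (⊛-agree-suc f (tail h ⊚ f) (partial m (tail h) f) f₀≈0 m
                      (⊚-partial f f₀≈0 m (tail h)) m ℕ.≤-refl)))

  -- A family of series satisfying Φ i ≋ B i ⊕ f ⊛ Φ (s i) with f 0 ≈ 0# is
  -- determined by B; with ⊚-horner this gives all algebraic laws of ⊚.
  recursion-unique : ∀ {a} {I : Set a} f → f 0 ≈ 0# → (s : I → I) (B Φ Ψ : I → Series) →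
                     (∀ i → Φ i ≋ B i ⊕ f ⊛ Φ (s i)) → (∀ i → Ψ i ≋ B i ⊕ f ⊛ Ψ (s i)) →
                     ∀ i → Φ i ≋ Ψ i
  recursion-unique f f₀≈0 s B Φ Ψ Φ-rec Ψ-rec i m = go (suc m) i m ℕ.≤-refl
    where
    go : ∀ n i → Agree n (Φ i) (Ψ i)
    go zero    i j ()
    go (suc n) i j j<n =
      trans (Φ-rec i j)
        (trans (+-congˡ (⊛-agree-suc f (Φ (s i)) (Ψ (s i)) f₀≈0 n (go n (s i)) j j<n))
               (sym (Ψ-rec i j)))

  ⊚-congˡ : ∀ {g h} f → g ≋ h → g ⊚ f ≋ h ⊚ f
  ⊚-congˡ f p m = sum-cong-≋ {suc m} (λ n → *-congʳ {(f ^ toℕ n) m} (p (toℕ n)))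

  ^-agree : ∀ n {f g} → Agree n f g → ∀ k → Agree n (f ^ k) (g ^ k)
  ^-agree n p zero    _ _ = refl
  ^-agree n p (suc k)     = ⊛-agree n p (^-agree n p k)

  ⊚-agreeʳ : ∀ n h {f g} → Agree n f g → Agree n (h ⊚ f) (h ⊚ g)
  ⊚-agreeʳ n h p m m<n =
    sum-cong-≋ {suc m} (λ k → *-congˡ {h (toℕ k)} (^-agree n p (toℕ k) m m<n))

  ⊚-congʳ : ∀ h {f g} → f ≋ g → h ⊚ f ≋ h ⊚ g
  ⊚-congʳ h p m = ⊚-agreeʳ (suc m) h (≋⇒agree _ p) m ℕ.≤-refl

  ⊚-constant : ∀ f → f 0 ≈ 0# → ∀ h → (h ⊚ f) 0 ≈ h 0
  ⊚-constant f f₀≈0 h =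
    trans (⊚-horner f f₀≈0 h 0)
      (trans (+-congˡ (zero-⊛ f (tail h ⊚ f) f₀≈0)) (+-identityʳ _))

  ⊚-⊕ : ∀ f → f 0 ≈ 0# → ∀ g h → (g ⊕ h) ⊚ f ≋ g ⊚ f ⊕ h ⊚ f
  ⊚-⊕ f f₀≈0 g h =
    recursion-unique f f₀≈0 (λ (g , h) → tail g , tail h) (λ (g , h) → C (g 0) ⊕ C (h 0))
      (λ (g , h) → (g ⊕ h) ⊚ f) (λ (g , h) → g ⊚ f ⊕ h ⊚ f)
      (λ (g , h) m → trans (⊚-horner f f₀≈0 (g ⊕ h) m) (+-congʳ (C-+ (g 0) (h 0) m)))
      (λ (g , h) → 𝕊.trans (𝕊.+-cong (⊚-horner f f₀≈0 g) (⊚-horner f f₀≈0 h))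
        (solve𝕊 5 (λ a b x u v → (a ⊞ (x ⊠ u)) ⊞ (b ⊞ (x ⊠ v)) ≐ (a ⊞ b) ⊞ (x ⊠ (u ⊞ v)))
          𝕊.refl (C (g 0)) (C (h 0)) f (tail g ⊚ f) (tail h ⊚ f)))
      (g , h)

  ⊚-C : ∀ f → f 0 ≈ 0# → ∀ a → C a ⊚ f ≋ C a
  ⊚-C f f₀≈0 =
    -- The tail of any constant is the constant 0, so scalars index the family and the successor map
    -- is constantly 0.
    recursion-unique f f₀≈0 (λ _ → 0#) C (λ a → C a ⊚ f) C
      (λ a m → trans (⊚-horner f f₀≈0 (C a) m)
        (+-congˡ (⊛-cong (𝕊.refl {f}) (⊚-congˡ f (λ n → sym (C0≈0 n))) m)))
      (λ a → 𝕊.sym (𝕊.trans (𝕊.+-congˡ {C a} (𝕊.zeroʳ f)) (𝕊.+-identityʳ (C a))))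

  ⊚-• : ∀ f → f 0 ≈ 0# → ∀ a h → (a • h) ⊚ f ≋ a • (h ⊚ f)
  ⊚-• f f₀≈0 a =
    recursion-unique f f₀≈0 tail (λ h → C (a * h 0)) (λ h → (a • h) ⊚ f) (λ h → a • (h ⊚ f))
      (λ h → ⊚-horner f f₀≈0 (a • h))
      (λ h m → trans (*-congˡ (⊚-horner f f₀≈0 h m))
        (trans (distribˡ a _ _)
          (+-cong (sym (C-* a (h 0) m)) (sym (⊛-• a f (tail h ⊚ f) m)))))

  ⊚-⊛ : ∀ f → f 0 ≈ 0# → ∀ g h → (g ⊛ h) ⊚ f ≋ (g ⊚ f) ⊛ (h ⊚ f)
  ⊚-⊛ f f₀≈0 g h =
    -- Only `g` runs through its tails; `h` stays fixed and enters through the inhomogeneous term.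
    recursion-unique f f₀≈0 tail (λ g → g 0 • (h ⊚ f)) (λ g → (g ⊛ h) ⊚ f)
      (λ g → (g ⊚ f) ⊛ (h ⊚ f)) product-rec
      (λ g → 𝕊.trans (⊛-cong (⊚-horner f f₀≈0 g) (𝕊.refl {h ⊚ f}))
        (𝕊.trans (𝕊.distribʳ (h ⊚ f) (C (g 0)) (f ⊛ (tail g ⊚ f)))
          (𝕊.+-cong (C-⊛ (g 0) (h ⊚ f)) (𝕊.*-assoc f (tail g ⊚ f) (h ⊚ f)))))
      g
    where
    open SetoidReasoning 𝕊.setoid
    product-rec : ∀ g → (g ⊛ h) ⊚ f ≋ g 0 • (h ⊚ f) ⊕ f ⊛ ((tail g ⊛ h) ⊚ f)
    product-rec g = begin
      (g ⊛ h) ⊚ f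
        ≈⟨ ⊚-horner f f₀≈0 (g ⊛ h) ⟩
      -- The tail of `g ⊛ h` unfolds by definition into the displayed sum, and `0#` is the empty
      -- rest of the sum for the constant term.
      C (g 0 * h 0 + 0#) ⊕ f ⊛ ((g 0 • tail h ⊕ tail g ⊛ h) ⊚ f)
        ≈⟨ 𝕊.+-cong (C-cong (+-identityʳ (g 0 * h 0)))
             (𝕊.*-congˡ {f} (𝕊.trans (⊚-⊕ f f₀≈0 (g 0 • tail h) (tail g ⊛ h))
               (𝕊.+-congʳ {(tail g ⊛ h) ⊚ f} (⊚-• f f₀≈0 (g 0) (tail h))))) ⟩
      C (g 0 * h 0) ⊕ f ⊛ (g 0 • (tail h ⊚ f) ⊕ (tail g ⊛ h) ⊚ f)
        ≈⟨ 𝕊.+-cong (C-* (g 0) (h 0))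
             (⊛-distribˡ f (g 0 • (tail h ⊚ f)) ((tail g ⊛ h) ⊚ f)) ⟩
      g 0 • C (h 0) ⊕ (f ⊛ (g 0 • (tail h ⊚ f)) ⊕ f ⊛ ((tail g ⊛ h) ⊚ f))
        ≈⟨ 𝕊.+-congˡ {g 0 • C (h 0)}
             (𝕊.+-congʳ {f ⊛ ((tail g ⊛ h) ⊚ f)} (⊛-• (g 0) f (tail h ⊚ f))) ⟩
      g 0 • C (h 0) ⊕ (g 0 • (f ⊛ (tail h ⊚ f)) ⊕ f ⊛ ((tail g ⊛ h) ⊚ f))
        ≈⟨ (λ m → solve 4 (λ a c x y → a :* c :+ (a :* x :+ y) := a :* (c :+ x) :+ y)
                  refl (g 0) (C (h 0) m) ((f ⊛ (tail h ⊚ f)) m) _) ⟩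
      g 0 • (C (h 0) ⊕ f ⊛ (tail h ⊚ f)) ⊕ f ⊛ ((tail g ⊛ h) ⊚ f)
        ≈⟨ (λ m → +-congʳ (*-congˡ (sym (⊚-horner f f₀≈0 h m)))) ⟩
      g 0 • (h ⊚ f) ⊕ f ⊛ ((tail g ⊛ h) ⊚ f) ∎

  ⊚-^ : ∀ f → f 0 ≈ 0# → ∀ g n → (g ^ n) ⊚ f ≋ (g ⊚ f) ^ n
  ⊚-^ f f₀≈0 g zero    = ⊚-C f f₀≈0 1#
  ⊚-^ f f₀≈0 g (suc n) =
    𝕊.trans (⊚-⊛ f f₀≈0 g (g ^ n)) (𝕊.*-congˡ {g ⊚ f} (⊚-^ f f₀≈0 g n))

  ⊚-⊖ : ∀ f → f 0 ≈ 0# → ∀ g → (⊖ g) ⊚ f ≋ ⊖ (g ⊚ f)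
  ⊚-⊖ f f₀≈0 g =
    +-inverseˡ-unique ((⊖ g) ⊚ f) (g ⊚ f)
      (𝕊.trans (𝕊.sym (⊚-⊕ f f₀≈0 (⊖ g) g))
        (𝕊.trans (⊚-congˡ f (𝕊.-‿inverseˡ g)) (⊚-C f f₀≈0 0#)))
    where open Algebra.Properties.Ring 𝕊.ring using (+-inverseˡ-unique)

  X⊚ : ∀ f → f 0 ≈ 0# → X ⊚ f ≋ f
  X⊚ f f₀≈0 = begin
    X ⊚ f                     ≈⟨ ⊚-horner f f₀≈0 X ⟩
    C 0# ⊕ f ⊛ (tail X ⊚ f)   ≈⟨ 𝕊.+-identityˡ (f ⊛ (tail X ⊚ f)) ⟩
    f ⊛ (tail X ⊚ f)          ≈⟨ 𝕊.*-congˡ {f} (𝕊.trans (⊚-congˡ f tail-X) (⊚-C f f₀≈0 1#)) ⟩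
    f ⊛ C 1#                  ≈⟨ 𝕊.*-identityʳ f ⟩
    f                         ∎
    where open SetoidReasoning 𝕊.setoid

  ⊚X : ∀ h → h ⊚ X ≋ h
  ⊚X = recursion-unique X refl tail (λ h → C (h 0)) (_⊚ X) (λ h → h) (⊚-horner X refl) decompose

  ⊚-assoc : ∀ f → f 0 ≈ 0# → ∀ g → g 0 ≈ 0# → ∀ h → (h ⊚ g) ⊚ f ≋ h ⊚ (g ⊚ f)
  ⊚-assoc f f₀≈0 g g₀≈0 =
    -- Both sides obey the Horner recursion of the inner series `g ⊚ f`, not of `f`.
    recursion-unique (g ⊚ f) gf₀≈0 tail (λ h → C (h 0)) (λ h → (h ⊚ g) ⊚ f)
      (λ h → h ⊚ (g ⊚ f)) left-rec (⊚-horner (g ⊚ f) gf₀≈0)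
    where
    open SetoidReasoning 𝕊.setoid
    gf₀≈0 : (g ⊚ f) 0 ≈ 0#
    gf₀≈0 = trans (⊚-constant f f₀≈0 g) g₀≈0
    left-rec : ∀ h → (h ⊚ g) ⊚ f ≋ C (h 0) ⊕ (g ⊚ f) ⊛ ((tail h ⊚ g) ⊚ f)
    left-rec h = begin
      (h ⊚ g) ⊚ f
        ≈⟨ ⊚-congˡ f (⊚-horner g g₀≈0 h) ⟩
      (C (h 0) ⊕ g ⊛ (tail h ⊚ g)) ⊚ f
        ≈⟨ ⊚-⊕ f f₀≈0 (C (h 0)) (g ⊛ (tail h ⊚ g)) ⟩
      C (h 0) ⊚ f ⊕ (g ⊛ (tail h ⊚ g)) ⊚ f
        ≈⟨ 𝕊.+-cong (⊚-C f f₀≈0 (h 0)) (⊚-⊛ f f₀≈0 g (tail h ⊚ g)) ⟩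
      C (h 0) ⊕ (g ⊚ f) ⊛ ((tail h ⊚ g) ⊚ f) ∎

  ⊚-linear-coefficient : ∀ F → F 0 ≈ 0# → ∀ h → (h ⊚ F) 1 ≈ F 1 * h 1
  ⊚-linear-coefficient F F₀≈0 h =
    trans (⊚-horner F F₀≈0 h 1)
      (trans (+-identityˡ _)
        (trans (suc-⊛ F (tail h ⊚ F) F₀≈0 0)
          (trans (+-identityʳ _) (*-congˡ (⊚-constant F F₀≈0 (tail h))))))

  -- Linear coefficients multiply under composition. This makes the linear coefficient of `F`
  -- invertible and determines that of a competitor `K` up to sign.
  square-linear : ∀ K → K 0 ≈ 0# → K ⊚ K ≋ X → K 1 * K 1 ≈ 1#
  square-linear K K₀≈0 K⊚K≋X = trans (sym (⊚-linear-coefficient K K₀≈0 K)) (K⊚K≋X 1)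

-- Fixed points, reciprocals and compositional inverses.

module Inverses {c ℓ₁ ℓ₂ : Level} (𝔽 : HeytingField c ℓ₁ ℓ₂) where
  open HeytingField 𝔽
  open PowerSeries 𝔽
  open SeriesRing 𝔽
  open Composition 𝔽

  -- Strict contraction in the x-adic metric.
  Contraction : (Series → Series) → Set _
  Contraction T = ∀ n f g → Agree n f g → Agree (suc n) (T f) (T g)

  iterate : (Series → Series) → ℕ → Series
  iterate T zero    = C 0#
  iterate T (suc n) = T (iterate T n)

  -- The limit of the iterates, taken diagonally: coefficient m no longer changes after `suc m`
  -- steps.
  fix : (Series → Series) → Series
  fix T m = iterate T (suc m) m

  module FixedPoint (T : Series → Series) (contraction : Contraction T) where

    iterate-stable : ∀ n → Agree n (iterate T n) (iterate T (suc n))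
    iterate-stable zero    i ()
    iterate-stable (suc n) = contraction n _ _ (iterate-stable n)

    fix-iterate : ∀ n → Agree n (fix T) (iterate T n)
    fix-iterate n i i<n = go (ℕ.≤⇒≤′ i<n)
      where
      go : ∀ {n} → i ℕ.<′ n → fix T i ≈ iterate T n i
      go ℕ.<′-base      = refl
      go (ℕ.≤′-step lt) = trans (go lt) (iterate-stable _ i (ℕ.≤′⇒≤ lt))

    fix-fixed : fix T ≋ T (fix T)
    fix-fixed m = sym (contraction m (fix T) (iterate T m) (fix-iterate m) m ℕ.≤-refl)

  x-0≈x : ∀ x → x - 0# ≈ x
  x-0≈x x = trans (+-congˡ -0#≈0#) (+-identityʳ x)
    where open Algebra.Properties.Ring 𝕂.ring using (-0#≈0#)

  inv-inverseʳ : ∀ {x} (x#0 : x # 0#) → x * inv x#0 ≈ 1#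
  inv-inverseʳ x#0 = trans (*-congʳ (sym (x-0≈x _))) (proj₂ (proj₂ (#⇒invertible x#0)))

  -- Apartness from 0 is obtained by exhibiting an inverse; all apartness facts that are not
  -- hypotheses arise this way.
  inverse⇒#0 : ∀ {x y} → x * y ≈ 1# → x # 0#
  inverse⇒#0 {x} {y} xy≈1 = invertible⇒# (y , trans (*-comm y _) [x-0]y≈1 , [x-0]y≈1)
    where
    [x-0]y≈1 : (x - 0#) * y ≈ 1#
    [x-0]y≈1 = trans (*-congʳ (x-0≈x x)) xy≈1

  constant-one⇒#0 : ∀ {x} → x ≈ 1# → x # 0#
  constant-one⇒#0 x≈1 = inverse⇒#0 (trans (*-identityʳ _) x≈1)

  •-cancel : ∀ {x} → x # 0# → ∀ p q → x • p ≋ x • q → p ≋ q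
  •-cancel x#0 p q xp≋xq m = trans (unscale p m) (trans (*-congˡ (xp≋xq m)) (sym (unscale q m)))
    where
    unscale : ∀ p m → p m ≈ inv x#0 * (_ * p m)
    unscale p m = sym (trans (sym (*-assoc _ _ _))
      (trans (*-congʳ (trans (*-comm _ _) (inv-inverseʳ x#0))) (*-identityˡ _)))

  -- For f = f₀ + x·f′ the reciprocal b is the fixed point of b ↦ f₀⁻¹ (1 - x·f′·b).
  module Reciprocal (f : Series) (f₀#0 : f 0 # 0#) where

    step : Series → Series
    step b = inv f₀#0 • (C 1# ⊕ ⊖ (X ⊛ (tail f ⊛ b)))

    step-contraction : Contraction step
    step-contraction n b b′ p i i<n =
      *-congˡ (+-congˡ (-‿cong
        (⊛-agree-suc X (tail f ⊛ b) (tail f ⊛ b′) refl n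
          (⊛-agree n {tail f} (λ _ _ → refl) p) i i<n)))

    open FixedPoint step step-contraction

    reciprocal : Series
    reciprocal = fix step

    ⊛-reciprocal : f ⊛ reciprocal ≋ C 1#
    ⊛-reciprocal = begin
      f ⊛ b
        ≈⟨ 𝕊.*-congʳ {b} (decompose f) ⟩
      (C (f 0) ⊕ X ⊛ tail f) ⊛ b
        ≈⟨ 𝕊.distribʳ b (C (f 0)) (X ⊛ tail f) ⟩
      C (f 0) ⊛ b ⊕ (X ⊛ tail f) ⊛ b
        ≈⟨ 𝕊.+-cong (𝕊.trans (C-⊛ (f 0) b) scaled) (𝕊.*-assoc X (tail f) b) ⟩
      (C 1# ⊕ ⊖ u) ⊕ u
        ≈⟨ 𝕊.+-assoc (C 1#) (⊖ u) u ⟩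
      C 1# ⊕ (⊖ u ⊕ u)
        ≈⟨ 𝕊.+-congˡ {C 1#} (𝕊.-‿inverseˡ u) ⟩
      C 1# ⊕ C 0#
        ≈⟨ 𝕊.+-identityʳ (C 1#) ⟩
      C 1# ∎
      where
      open SetoidReasoning 𝕊.setoid
      b u : Series
      b = reciprocal
      u = X ⊛ (tail f ⊛ b)
      scaled : f 0 • b ≋ C 1# ⊕ ⊖ u
      scaled m = trans (*-congˡ (fix-fixed m))
        (trans (sym (*-assoc (f 0) (inv f₀#0) _))
          (trans (*-congʳ (inv-inverseʳ f₀#0)) (*-identityˡ _)))

  open Reciprocal public using (reciprocal; ⊛-reciprocal)

  reciprocal-constant : ∀ f (f₀#0 : f 0 # 0#) → f 0 * reciprocal f f₀#0 0 ≈ 1#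
  reciprocal-constant f f₀#0 = trans (sym (+-identityʳ _)) (⊛-reciprocal f f₀#0 0)

  -- (x·κ)(h) = h·κ(h) equals x exactly when h = x·κ⁻¹(h).
  module RightInverse (κ : Series) (κ₀#0 : κ 0 # 0#) where

    κ⁻¹ : Series
    κ⁻¹ = reciprocal κ κ₀#0

    step : Series → Series
    step h = X ⊛ (κ⁻¹ ⊚ h)

    step-contraction : Contraction step
    step-contraction n g h p =
      ⊛-agree-suc X (κ⁻¹ ⊚ g) (κ⁻¹ ⊚ h) refl n (⊚-agreeʳ n κ⁻¹ p)

    open FixedPoint step step-contraction

    rightInverse : Series
    rightInverse = fix step

    rightInverse-unfold : rightInverse ≋ X ⊛ (κ⁻¹ ⊚ rightInverse)
    rightInverse-unfold = fix-fixed

    constant : rightInverse 0 ≈ 0#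
    constant = trans (fix-fixed 0) (zero-⊛ X (κ⁻¹ ⊚ rightInverse) refl)

    inverseʳ : (X ⊛ κ) ⊚ rightInverse ≋ X
    inverseʳ = begin
      (X ⊛ κ) ⊚ h         ≈⟨ ⊚-⊛ h constant X κ ⟩
      (X ⊚ h) ⊛ (κ ⊚ h)   ≈⟨ 𝕊.*-congʳ {κ ⊚ h} (𝕊.trans (X⊚ h constant) fix-fixed) ⟩
      X ⊛ (κ⁻¹ ⊚ h) ⊛ (κ ⊚ h) ≈⟨ 𝕊.*-assoc X (κ⁻¹ ⊚ h) (κ ⊚ h) ⟩
      X ⊛ ((κ⁻¹ ⊚ h) ⊛ (κ ⊚ h)) ≈⟨ 𝕊.*-congˡ {X} unit ⟩
      X ⊛ C 1#            ≈⟨ 𝕊.*-identityʳ X ⟩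
      X                   ∎
      where
      open SetoidReasoning 𝕊.setoid
      h : Series
      h = rightInverse
      unit : (κ⁻¹ ⊚ h) ⊛ (κ ⊚ h) ≋ C 1#
      unit = 𝕊.trans (𝕊.sym (⊚-⊛ h constant κ⁻¹ κ))
        (𝕊.trans (⊚-congˡ h (𝕊.trans (⊛-comm κ⁻¹ κ) (⊛-reciprocal κ κ₀#0))) (⊚-C h constant 1#))

  -- A right inverse h of X ⊛ κ has again the form X ⊛ κ′ with κ′ 0 invertible, so
  -- it has a right inverse k; then k = (f ∘ h) ∘ k = f.
  compositionalInverse : ∀ κ → κ 0 # 0# → ∃ λ h → IsCompositionalInverse (X ⊛ κ) h
  compositionalInverse κ κ₀#0 = h , record
    { constant = R.constant
    ; inverseʳ = R.inverseʳ
    ; inverseˡ = 𝕊.trans (⊚-congʳ h f≋k) h⊚k≋X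
    }
    where
    open SetoidReasoning 𝕊.setoid
    module R = RightInverse κ κ₀#0
    f h κ′ : Series
    f = X ⊛ κ
    h = R.rightInverse
    κ′ = R.κ⁻¹ ⊚ h
    κ′₀κ₀≈1 : κ′ 0 * κ 0 ≈ 1#
    κ′₀κ₀≈1 = trans (*-comm _ _)
      (trans (*-congˡ (⊚-constant h R.constant R.κ⁻¹)) (reciprocal-constant κ κ₀#0))
    module R′ = RightInverse κ′ (inverse⇒#0 κ′₀κ₀≈1)
    k : Series
    k = R′.rightInverse
    h⊚k≋X : h ⊚ k ≋ X
    h⊚k≋X = 𝕊.trans (⊚-congˡ k R.rightInverse-unfold) R′.inverseʳ
    f≋k : f ≋ k
    f≋k = begin
      f              ≈⟨ ⊚X f ⟨
      f ⊚ X          ≈⟨ ⊚-congʳ f h⊚k≋X ⟨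
      f ⊚ (h ⊚ k)    ≈⟨ ⊚-assoc k R′.constant h R.constant f ⟨
      (f ⊚ h) ⊚ k    ≈⟨ ⊚-congˡ k R.inverseʳ ⟩
      X ⊚ k          ≈⟨ X⊚ k R′.constant ⟩
      k              ∎

-- Extraction of roots with constant term 1.

module Roots {c ℓ₁ ℓ₂ : Level} (𝔽 : HeytingField c ℓ₁ ℓ₂) where
  open HeytingField 𝔽
  open PowerSeries 𝔽
  open SeriesRing 𝔽
  open Composition 𝔽
  open Inverses 𝔽
  open RawSemiringDefinitions (Semiring.rawSemiring 𝕂.semiring) using () renaming (_×_ to _·ℕ_)
  open Algebra.Properties.Ring 𝕊.ring using (//-rightDividesˡ; //-rightDividesʳ)

  ^-constant : ∀ f → f 0 ≈ 1# → ∀ n → (f ^ n) 0 ≈ 1#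
  ^-constant f f₀≈1 zero    = refl
  ^-constant f f₀≈1 (suc n) =
    trans (+-identityʳ _) (trans (*-cong f₀≈1 (^-constant f f₀≈1 n)) (*-identityˡ 1#))

  ^-linear : ∀ f → f 0 ≈ 1# → ∀ n → (f ^ n) 1 ≈ n ·ℕ f 1
  ^-linear f f₀≈1 zero    = refl
  ^-linear f f₀≈1 (suc n) =
    trans (+-cong (trans (*-cong f₀≈1 (^-linear f f₀≈1 n)) (*-identityˡ _))
                  (trans (+-identityʳ _)
                    (trans (*-congˡ (^-constant f f₀≈1 n)) (*-identityʳ (f 1)))))
          (+-comm _ _)

  ^-even-constant : ∀ f → f 0 * f 0 ≈ 1# → ∀ j → (f ^ (j ℕ.* 2)) 0 ≈ 1#
  ^-even-constant f f₀²≈1 zero    = refl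
  ^-even-constant f f₀²≈1 (suc j) =
    trans (+-identityʳ _)
      (trans (*-congˡ (trans (+-identityʳ _) (*-congˡ (^-even-constant f f₀²≈1 j))))
        (trans (*-congˡ (*-identityʳ (f 0))) f₀²≈1))

  -- If `e² = 1` then `eʳ = e` for odd r. Writing r as `suc (j * 2)` makes the power unfold into one
  -- factor followed by pairs.
  ^-odd-constant : ∀ f → f 0 * f 0 ≈ 1# → ∀ n → n % 2 ≡ 1 → (f ^ n) 0 ≈ f 0
  ^-odd-constant f f₀²≈1 n n%2≡1 with j , ≡.refl ← odd⇒suc-double n n%2≡1 =
    trans (+-identityʳ _) (trans (*-congˡ (^-even-constant f f₀²≈1 j)) (*-identityʳ (f 0)))

  -- Let Q be the compositional inverse of P = (1 + x)ⁿ⁺¹ - 1.  Then bⁿ⁺¹ = a says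
  -- P(b - 1) = a - 1, so b = 1 + Q(a - 1): existence uses P ∘ Q = x, uniqueness Q ∘ P = x.
  module Root (char0 : CharacteristicZero) (n : ℕ) where
    open SetoidReasoning 𝕊.setoid

    X+1₀≈1 : (X ⊕ C 1#) 0 ≈ 1#
    X+1₀≈1 = +-identityˡ 1#

    P : Series
    P = (X ⊕ C 1#) ^ suc n ⊕ ⊖ C 1#

    P₀≈0 : P 0 ≈ 0#
    P₀≈0 = trans (+-congʳ (^-constant (X ⊕ C 1#) X+1₀≈1 (suc n))) (-‿inverseʳ 1#)

    P₁≈n : P 1 ≈ suc n ·ℕ 1#
    P₁≈n = trans (x-0≈x _) (trans (^-linear (X ⊕ C 1#) X+1₀≈1 (suc n)) (·-cong (suc n)))
      where
      ·-cong : ∀ k → k ·ℕ (1# + 0#) ≈ k ·ℕ 1#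
      ·-cong zero    = refl
      ·-cong (suc k) = +-cong (+-identityʳ 1#) (·-cong k)

    -- Inversion expects a visible factor `X`, hence `X ⊛ tail P` in place of `P`. Its cofactor
    -- starts with `suc n` times 1, invertible by characteristic zero.
    Q-inverse : ∃ λ Q → IsCompositionalInverse (X ⊛ tail P) Q
    Q-inverse = compositionalInverse (tail P)
      (inverse⇒#0 (trans (*-congʳ P₁≈n) (inv-inverseʳ (char0 n))))

    Q : Series
    Q = proj₁ Q-inverse

    open IsCompositionalInverse (proj₂ Q-inverse)

    P⊚Q≋X : P ⊚ Q ≋ X
    P⊚Q≋X = 𝕊.trans (⊚-congˡ Q (X⊛-tail P P₀≈0)) inverseʳ

    Q⊚P≋X : Q ⊚ P ≋ X
    Q⊚P≋X = 𝕊.trans (⊚-congʳ Q (X⊛-tail P P₀≈0)) inverseˡ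

    -- Substitution of `w` into `(1 + x)^(n+1) = P + 1`. It turns an equation for the power of `b`
    -- into one for `P` at `w = b - 1`.
    power-P : ∀ w → w 0 ≈ 0# → (w ⊕ C 1#) ^ suc n ≋ P ⊚ w ⊕ C 1#
    power-P w w₀≈0 = begin
      (w ⊕ C 1#) ^ suc n
        ≈⟨ ^-cong (suc n) (𝕊.+-cong (X⊚ w w₀≈0) (⊚-C w w₀≈0 1#)) ⟨
      (X ⊚ w ⊕ C 1# ⊚ w) ^ suc n
        ≈⟨ ^-cong (suc n) (⊚-⊕ w w₀≈0 X (C 1#)) ⟨
      ((X ⊕ C 1#) ⊚ w) ^ suc n
        ≈⟨ ⊚-^ w w₀≈0 (X ⊕ C 1#) (suc n) ⟨
      ((X ⊕ C 1#) ^ suc n) ⊚ w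
        ≈⟨ ⊚-congˡ w (//-rightDividesˡ (C 1#) ((X ⊕ C 1#) ^ suc n)) ⟨
      (P ⊕ C 1#) ⊚ w
        ≈⟨ ⊚-⊕ w w₀≈0 P (C 1#) ⟩
      P ⊚ w ⊕ C 1# ⊚ w
        ≈⟨ 𝕊.+-congˡ {P ⊚ w} (⊚-C w w₀≈0 1#) ⟩
      P ⊚ w ⊕ C 1# ∎

    root : ∀ a → a 0 ≈ 1# → ∃ λ b → IsRoot (suc n) a b
    root a a₀≈1 = Q ⊚ u ⊕ C 1# , record
      { constant = trans (+-congʳ w₀≈0) (+-identityˡ 1#)
      ; power = begin
          (Q ⊚ u ⊕ C 1#) ^ suc n   ≈⟨ power-P (Q ⊚ u) w₀≈0 ⟩
          P ⊚ (Q ⊚ u) ⊕ C 1#       ≈⟨ 𝕊.+-congʳ {C 1#} P⊚Q⊚u≋u ⟩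
          u ⊕ C 1#                 ≈⟨ //-rightDividesˡ (C 1#) a ⟩
          a                        ∎
      ; unique = unique
      }
      where
      minus-one₀ : ∀ b → b 0 ≈ 1# → (b ⊕ ⊖ C 1#) 0 ≈ 0#
      minus-one₀ b b₀≈1 = trans (+-congʳ b₀≈1) (-‿inverseʳ 1#)
      u : Series
      u = a ⊕ ⊖ C 1#
      u₀≈0 : u 0 ≈ 0#
      u₀≈0 = minus-one₀ a a₀≈1
      w₀≈0 : (Q ⊚ u) 0 ≈ 0#
      w₀≈0 = trans (⊚-constant u u₀≈0 Q) constant
      P⊚Q⊚u≋u : P ⊚ (Q ⊚ u) ≋ u
      P⊚Q⊚u≋u = begin
        P ⊚ (Q ⊚ u)   ≈⟨ ⊚-assoc u u₀≈0 Q constant P ⟨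
        (P ⊚ Q) ⊚ u   ≈⟨ ⊚-congˡ u P⊚Q≋X ⟩
        X ⊚ u         ≈⟨ X⊚ u u₀≈0 ⟩
        u             ∎
      unique : ∀ b → b 0 ≈ 1# → b ^ suc n ≋ a → b ≋ Q ⊚ u ⊕ C 1#
      unique b b₀≈1 bⁿ≋a = begin
        b                    ≈⟨ //-rightDividesˡ (C 1#) b ⟨
        v ⊕ C 1#             ≈⟨ 𝕊.+-congʳ {C 1#} (X⊚ v v₀≈0) ⟨
        X ⊚ v ⊕ C 1#         ≈⟨ 𝕊.+-congʳ {C 1#} (⊚-congˡ v Q⊚P≋X) ⟨
        (Q ⊚ P) ⊚ v ⊕ C 1#   ≈⟨ 𝕊.+-congʳ {C 1#} (⊚-assoc v v₀≈0 P P₀≈0 Q) ⟩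
        Q ⊚ (P ⊚ v) ⊕ C 1#   ≈⟨ 𝕊.+-congʳ {C 1#} (⊚-congʳ Q P⊚v≋u) ⟩
        Q ⊚ u ⊕ C 1#         ∎
        where
        v : Series
        v = b ⊕ ⊖ C 1#
        v₀≈0 : v 0 ≈ 0#
        v₀≈0 = minus-one₀ b b₀≈1
        P⊚v≋u : P ⊚ v ≋ u
        P⊚v≋u = begin
          P ⊚ v                          ≈⟨ //-rightDividesʳ (C 1#) (P ⊚ v) ⟨
          P ⊚ v ⊕ C 1# ⊕ ⊖ C 1#          ≈⟨ 𝕊.+-congʳ {⊖ C 1#} (power-P v v₀≈0) ⟨
          (v ⊕ C 1#) ^ suc n ⊕ ⊖ C 1#    ≈⟨ 𝕊.+-congʳ {⊖ C 1#} (^-cong (suc n)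
                                              (//-rightDividesˡ (C 1#) b)) ⟩
          b ^ suc n ⊕ ⊖ C 1#             ≈⟨ 𝕊.+-congʳ {⊖ C 1#} bⁿ≋a ⟩
          u                              ∎

  root : CharacteristicZero → ∀ r → 1 ≤ r → ∀ a → a 0 ≈ 1# → ∃ λ b → IsRoot r a b
  root char0 (suc n) _ = Root.root char0 n

  -- Both series are compared with the chosen r-th root of `d ^ r`.
  root-unique : CharacteristicZero → ∀ r → 1 ≤ r → ∀ b d → b 0 ≈ 1# → d 0 ≈ 1# →
                b ^ r ≋ d ^ r → b ≋ d
  root-unique char0 r 1≤r b d b₀≈1 d₀≈1 bʳ≋dʳ =
    𝕊.trans (unique b b₀≈1 bʳ≋dʳ) (𝕊.sym (unique d d₀≈1 (𝕊.refl {d ^ r})))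
    where open IsRoot (proj₂ (root char0 r 1≤r (d ^ r) (^-constant d d₀≈1 r))) using (unique)

-- Signs and inverses in an arbitrary commutative ring, for scalars and series alike.

module CommutativeRingFacts {a ℓ : Level} (R : CommutativeRing a ℓ) where
  open CommutativeRing R
  open Algebra.Properties.CommutativeSemiring.Exp commutativeSemiring using (_^_)
  open Algebra.Properties.Ring ring
  open Algebra.Solver.Ring.NaturalCoefficients.Default commutativeSemiring
    using (solve; _:=_; _:+_; _:*_)
  open SetoidReasoning setoid

  inverse-unique : ∀ x y z → x * y ≈ 1# → x * z ≈ 1# → y ≈ z
  inverse-unique x y z xy≈1 xz≈1 = begin
    y             ≈⟨ *-identityʳ y ⟨
    y * 1#        ≈⟨ *-congˡ xz≈1 ⟨
    y * (x * z)   ≈⟨ solve 3 (λ x y z → y :* (x :* z) := (x :* y) :* z) refl x y z ⟩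
    x * y * z     ≈⟨ *-congʳ xy≈1 ⟩
    1# * z        ≈⟨ *-identityˡ z ⟩
    z             ∎

  -x*-y≈x*y : ∀ x y → - x * - y ≈ x * y
  -x*-y≈x*y x y = begin
    - x * - y     ≈⟨ -‿distribˡ-* x (- y) ⟨
    - (x * - y)   ≈⟨ -‿cong (-‿distribʳ-* x y) ⟨
    - - (x * y)   ≈⟨ -‿involutive (x * y) ⟩
    x * y         ∎

  square-one : ∀ {e} → e ≈ 1# ⊎ e ≈ - 1# → e * e ≈ 1#
  square-one (inj₁ e≈1)  = trans (*-cong e≈1 e≈1) (*-identityʳ 1#)
  square-one (inj₂ e≈-1) =
    trans (*-cong e≈-1 e≈-1) (trans (-x*-y≈x*y 1# 1#) (*-identityʳ 1#))

  -x^even : ∀ x k → (- x) ^ (k ℕ.* 2) ≈ x ^ (k ℕ.* 2)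
  -x^even x zero    = refl
  -x^even x (suc k) = begin
    - x * (- x * (- x) ^ (k ℕ.* 2))   ≈⟨ *-assoc (- x) (- x) _ ⟨
    - x * - x * (- x) ^ (k ℕ.* 2)     ≈⟨ *-cong (-x*-y≈x*y x x) (-x^even x k) ⟩
    x * x * x ^ (k ℕ.* 2)             ≈⟨ *-assoc x x _ ⟩
    x * (x * x ^ (k ℕ.* 2))           ∎

  -x^odd : ∀ x n → n % 2 ≡ 1 → (- x) ^ n ≈ - (x ^ n)
  -x^odd x n n%2≡1 with k , ≡.refl ← odd⇒suc-double n n%2≡1 =
    trans (*-congˡ (-x^even x k)) (sym (-‿distribˡ-* x _))

  -- Both `x * t` and `e` are inverses of `e`.
  involutive-unit : ∀ e x t → e * e ≈ 1# → e * x * t ≈ 1# → x * t ≈ e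
  involutive-unit e x t e²≈1 ext≈1 =
    inverse-unique e (x * t) e (trans (sym (*-assoc e x t)) ext≈1) e²≈1

  -- The product is `x e - w (x t) = (1 + e w) - e w`. With `x = g`, `w = gᵣ Gʳ` and `t = 1 / (ε g)`
  -- this is the last equality in the evaluation of `g ∘ F`.
  sum-inverse : ∀ e w x t → e * e ≈ 1# → x ≈ e + w → x * t ≈ e → x * (e + - (w * t)) ≈ 1#
  sum-inverse e w x t e²≈1 x≈e+w xt≈e = begin
    x * (e + - (w * t))             ≈⟨ distribˡ x e _ ⟩
    x * e + x * - (w * t)           ≈⟨ +-cong xe≈1+ew xwt≈-ew ⟩
    1# + e * w + - (e * w)          ≈⟨ //-rightDividesʳ (e * w) 1# ⟩
    1#                              ∎
    where
    xe≈1+ew : x * e ≈ 1# + e * w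
    xe≈1+ew = begin
      x * e           ≈⟨ *-congʳ x≈e+w ⟩
      (e + w) * e     ≈⟨ distribʳ e e w ⟩
      e * e + w * e   ≈⟨ +-cong e²≈1 (*-comm w e) ⟩
      1# + e * w      ∎
    xwt≈-ew : x * - (w * t) ≈ - (e * w)
    xwt≈-ew = begin
      x * - (w * t)   ≈⟨ -‿distribʳ-* x (w * t) ⟨
      - (x * (w * t)) ≈⟨ -‿cong (solve 3 (λ x w t → x :* (w :* t) := (x :* t) :* w) refl x w t) ⟩
      - (x * t * w)   ≈⟨ -‿cong (*-congʳ xt≈e) ⟩
      - (e * w)       ∎

-- Existence and uniqueness of the involution.

module Involution {c ℓ₁ ℓ₂ : Level} (𝔽 : HeytingField c ℓ₁ ℓ₂) where
  open HeytingField 𝔽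
  open PowerSeries 𝔽
  open SeriesRing 𝔽
  open Composition 𝔽
  open Inverses 𝔽
  open Roots 𝔽
  open SetoidReasoning 𝕊.setoid
  module 𝕂ᵖ = Algebra.Properties.Ring 𝕂.ring
  module 𝕊ᵖ = Algebra.Properties.Ring 𝕊.ring
  module 𝕊ᶠ = CommutativeRingFacts seriesRing

  -- The sign of the constant term enters only through `ε² = 1`, so no distinction between 1 and -1
  -- is carried along.
  module Construction
    (char0 : CharacteristicZero) (g : Series) (r : ℕ) (1≤r : 1 ≤ r) (r%2≡1 : r % 2 ≡ 1)
    (ε²≈1 : g 0 * g 0 ≈ 1#) (gᵢ≈0 : ∀ i → 1 ≤ i → i < r → g i ≈ 0#) (gᵣ#0 : g r # 0#) where

    ε : Carrier
    ε = g 0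

    ρ-root : ∃ λ ρ → IsRoot r (normalisedTail g r gᵣ#0) ρ
    ρ-root = root char0 r 1≤r (normalisedTail g r gᵣ#0) refl

    ρ : Series
    ρ = proj₁ ρ-root
    module ρ = IsRoot (proj₂ ρ-root)

    G : Series
    G = X ⊛ ρ

    G₀≈0 : G 0 ≈ 0#
    G₀≈0 = zero-⊛ X ρ refl

    W : Series
    W = g r • (G ^ r)

    G^r : G ^ r ≋ X ^ r ⊛ normalisedTail g r gᵣ#0
    G^r = 𝕊.trans (𝕊^.^-distrib-* X ρ r) (𝕊.*-congˡ {X ^ r} ρ.power)

    tail-coefficient : ∀ i → g r * normalisedTail g r gᵣ#0 i ≈ g (r ℕ.+ i)
    tail-coefficient zero rewrite ℕ.+-identityʳ r = *-identityʳ (g r)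
    tail-coefficient (suc i) rewrite ℕ.+-comm r (suc i) =
      trans (*-congˡ (*-comm _ _))
        (trans (sym (*-assoc _ _ _)) (trans (*-congʳ (inv-inverseʳ gᵣ#0)) (*-identityˡ _)))

    W-low : ∀ i → i < r → W i ≈ 0#
    W-low i i<r =
      trans (*-congˡ (trans (G^r i) (X^-low r (normalisedTail g r gᵣ#0) i i<r))) (zeroʳ (g r))

    W-high : ∀ i → W (r ℕ.+ i) ≈ g (r ℕ.+ i)
    W-high i = trans (*-congˡ (trans (G^r (r ℕ.+ i)) (X^-shift r (normalisedTail g r gᵣ#0) i)))
                     (tail-coefficient i)

    -- `W` is `X ^ r` times `gᵣ` times the normalised tail: it vanishes below degree r, where `g`
    -- has only its constant term, and reproduces `g` from degree r on.
    expansion : g ≋ C ε ⊕ W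
    expansion zero = sym (trans (+-congˡ (W-low 0 1≤r)) (+-identityʳ ε))
    expansion (suc i) with ℕ.<-≤-connex (suc i) r
    ... | inj₁ i<r = sym (trans (+-identityˡ _)
                       (trans (W-low (suc i) i<r) (sym (gᵢ≈0 (suc i) (s≤s z≤n) i<r))))
    ... | inj₂ r≤i with j , r+j≡i ← ℕ.m≤n⇒∃[o]m+o≡n r≤i =
      sym (trans (+-identityˡ _) (≡.subst (λ i → W i ≈ g i) r+j≡i (W-high j)))

    Ḡ-inverse : ∃ λ Ḡ → IsCompositionalInverse G Ḡ
    Ḡ-inverse = compositionalInverse ρ (constant-one⇒#0 ρ.constant)

    Ḡ : Series
    Ḡ = proj₁ Ḡ-inverse
    module Ḡ = IsCompositionalInverse (proj₂ Ḡ-inverse)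

    -- Used twice: with `y = G` for `F ∘ F = x`, and with `y = V` to identify a competitor with `F`.
    G-solve : ∀ u y → u 0 ≈ 0# → G ⊚ u ≋ y → u ≋ Ḡ ⊚ y
    G-solve u y u₀≈0 Gu≋y = begin
      u             ≈⟨ X⊚ u u₀≈0 ⟨
      X ⊚ u         ≈⟨ ⊚-congˡ u Ḡ.inverseˡ ⟨
      (Ḡ ⊚ G) ⊚ u   ≈⟨ ⊚-assoc u u₀≈0 G G₀≈0 Ḡ ⟩
      Ḡ ⊚ (G ⊚ u)   ≈⟨ ⊚-congʳ Ḡ Gu≋y ⟩
      Ḡ ⊚ y         ∎

    σ-root : ∃ λ σ → IsRoot r (ε • g) σ
    -- The constant term of `ε • g` is `ε * ε`, so `ε² = 1` is precisely what root extraction asks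
    -- for.
    σ-root = root char0 r 1≤r (ε • g) ε²≈1

    σ : Series
    σ = proj₁ σ-root
    module σ = IsRoot (proj₂ σ-root)

    τ : Series
    τ = reciprocal σ (constant-one⇒#0 σ.constant)

    σ⊛τ≋1 : σ ⊛ τ ≋ C 1#
    σ⊛τ≋1 = ⊛-reciprocal σ _

    τ₀≈1 : τ 0 ≈ 1#
    τ₀≈1 = trans (sym (*-identityˡ _))
      (trans (*-congʳ (sym σ.constant)) (reciprocal-constant σ _))

    εg⊛τ^r≋1 : (ε • g) ⊛ τ ^ r ≋ C 1#
    εg⊛τ^r≋1 = begin
      (ε • g) ⊛ τ ^ r   ≈⟨ 𝕊.*-congʳ {τ ^ r} σ.power ⟨
      σ ^ r ⊛ τ ^ r     ≈⟨ 𝕊^.^-distrib-* σ τ r ⟨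
      (σ ⊛ τ) ^ r       ≈⟨ ^-cong r σ⊛τ≋1 ⟩
      C 1# ^ r          ≈⟨ 1^ r ⟩
      C 1#              ∎

    Cε²≋1 : C ε ⊛ C ε ≋ C 1#
    Cε²≋1 = 𝕊.trans (C-⊛ ε (C ε)) (𝕊.trans (𝕊.sym (C-* ε ε)) (C-cong ε²≈1))

    g⊛τ^r≋Cε : g ⊛ τ ^ r ≋ C ε
    g⊛τ^r≋Cε = 𝕊ᶠ.involutive-unit (C ε) g (τ ^ r) Cε²≋1
      (𝕊.trans (𝕊.*-congʳ {τ ^ r} (C-⊛ ε g)) εg⊛τ^r≋1)

    -- The reciprocal is written in the shape that substituting `V` into the expansion of `g`
    -- produces.
    g⁻¹ : Series
    g⁻¹ = C ε ⊕ ⊖ (W ⊛ τ ^ r)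

    g⊛g⁻¹≋1 : g ⊛ g⁻¹ ≋ C 1#
    g⊛g⁻¹≋1 = 𝕊ᶠ.sum-inverse (C ε) W g (τ ^ r) Cε²≋1 expansion g⊛τ^r≋Cε

    V : Series
    V = ⊖ G ⊛ τ

    V₀≈0 : V 0 ≈ 0#
    V₀≈0 = zero-⊛ (⊖ G) τ (trans (-‿cong G₀≈0) 𝕂ᵖ.-0#≈0#)

    -- Oddness of r brings the sign of `⊖ G` out of the power.
    V^r : g r • (V ^ r) ≋ ⊖ (W ⊛ τ ^ r)
    V^r = begin
      g r • (V ^ r)
        ≈⟨ (λ m → *-congˡ (𝕊^.^-distrib-* (⊖ G) τ r m)) ⟩
      g r • ((⊖ G) ^ r ⊛ τ ^ r)
        ≈⟨ •-⊛ (g r) ((⊖ G) ^ r) (τ ^ r) ⟨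
      (g r • (⊖ G) ^ r) ⊛ τ ^ r
        ≈⟨ 𝕊.*-congʳ {τ ^ r} (λ m → trans (*-congˡ (𝕊ᶠ.-x^odd G r r%2≡1 m))
             (sym (𝕂ᵖ.-‿distribʳ-* (g r) ((G ^ r) m)))) ⟩
      (⊖ W) ⊛ τ ^ r
        ≈⟨ 𝕊ᵖ.-‿distribˡ-* W (τ ^ r) ⟨
      ⊖ (W ⊛ τ ^ r) ∎

    -- Stated for any substituted series, since it serves both the constructed `F` and a competitor
    -- `K`.
    g⊚ : ∀ F → F 0 ≈ 0# → g ⊚ F ≋ C ε ⊕ g r • ((G ⊚ F) ^ r)
    g⊚ F F₀≈0 = begin
      g ⊚ F                            ≈⟨ ⊚-congˡ F expansion ⟩
      (C ε ⊕ W) ⊚ F                    ≈⟨ ⊚-⊕ F F₀≈0 (C ε) W ⟩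
      C ε ⊚ F ⊕ W ⊚ F                  ≈⟨ 𝕊.+-cong (⊚-C F F₀≈0 ε) (⊚-• F F₀≈0 (g r) (G ^ r)) ⟩
      C ε ⊕ g r • ((G ^ r) ⊚ F)        ≈⟨ 𝕊.+-congˡ {C ε} (λ m → *-congˡ (⊚-^ F F₀≈0 G r m)) ⟩
      C ε ⊕ g r • ((G ⊚ F) ^ r)        ∎

    F : Series
    F = Ḡ ⊚ V

    F₀≈0 : F 0 ≈ 0#
    F₀≈0 = trans (⊚-constant V V₀≈0 Ḡ) Ḡ.constant

    G⊚F≋V : G ⊚ F ≋ V
    G⊚F≋V = begin
      G ⊚ (Ḡ ⊚ V)   ≈⟨ ⊚-assoc V V₀≈0 Ḡ Ḡ.constant G ⟨
      (G ⊚ Ḡ) ⊚ V   ≈⟨ ⊚-congˡ V Ḡ.inverseʳ ⟩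
      X ⊚ V         ≈⟨ X⊚ V V₀≈0 ⟩
      V             ∎

    g⊚F≋g⁻¹ : g ⊚ F ≋ g⁻¹
    g⊚F≋g⁻¹ = begin
      g ⊚ F                        ≈⟨ g⊚ F F₀≈0 ⟩
      C ε ⊕ g r • ((G ⊚ F) ^ r)    ≈⟨ 𝕊.+-congˡ {C ε} (λ m → *-congˡ (^-cong r G⊚F≋V m)) ⟩
      C ε ⊕ g r • (V ^ r)          ≈⟨ 𝕊.+-congˡ {C ε} V^r ⟩
      g⁻¹                          ∎

    g⊛[g⊚F]≋1 : g ⊛ (g ⊚ F) ≋ C 1#
    g⊛[g⊚F]≋1 = 𝕊.trans (𝕊.*-congˡ {g} g⊚F≋g⁻¹) g⊛g⁻¹≋1

    -- Both have constant term 1, and the r-th power of each is the inverse of `ε • g`: for `σ ⊚ F`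
    -- it is `ε • (g ⊚ F)`, where `g ⊚ F` is the inverse of `g` and `ε² = 1`.
    σ⊚F≋τ : σ ⊚ F ≋ τ
    σ⊚F≋τ = root-unique char0 r 1≤r (σ ⊚ F) τ
      (trans (⊚-constant F F₀≈0 σ) σ.constant) τ₀≈1
      (begin
        (σ ⊚ F) ^ r    ≈⟨ ⊚-^ F F₀≈0 σ r ⟨
        (σ ^ r) ⊚ F    ≈⟨ ⊚-congˡ F σ.power ⟩
        (ε • g) ⊚ F    ≈⟨ ⊚-• F F₀≈0 ε g ⟩
        ε • (g ⊚ F)    ≈⟨ 𝕊ᶠ.inverse-unique (ε • g) (ε • (g ⊚ F)) (τ ^ r) εg-inverse εg⊛τ^r≋1 ⟩
        τ ^ r          ∎)
      where
      εg-inverse : (ε • g) ⊛ (ε • (g ⊚ F)) ≋ C 1#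
      εg-inverse = begin
        (ε • g) ⊛ (ε • (g ⊚ F))     ≈⟨ •-⊛ ε g (ε • (g ⊚ F)) ⟩
        ε • (g ⊛ (ε • (g ⊚ F)))     ≈⟨ (λ m → *-congˡ (⊛-• ε g (g ⊚ F) m)) ⟩
        ε • (ε • (g ⊛ (g ⊚ F)))     ≈⟨ (λ m → trans (sym (*-assoc ε ε _))
                                           (trans (*-congʳ ε²≈1) (*-identityˡ _))) ⟩
        g ⊛ (g ⊚ F)                 ≈⟨ g⊛[g⊚F]≋1 ⟩
        C 1#                        ∎

    τ⊛[τ⊚F]≋1 : τ ⊛ (τ ⊚ F) ≋ C 1#
    τ⊛[τ⊚F]≋1 = begin
      τ ⊛ (τ ⊚ F)         ≈⟨ 𝕊.*-congʳ {τ ⊚ F} σ⊚F≋τ ⟨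
      (σ ⊚ F) ⊛ (τ ⊚ F)   ≈⟨ ⊚-⊛ F F₀≈0 σ τ ⟨
      (σ ⊛ τ) ⊚ F         ≈⟨ ⊚-congˡ F σ⊛τ≋1 ⟩
      C 1# ⊚ F            ≈⟨ ⊚-C F F₀≈0 1# ⟩
      C 1#                ∎

    V⊚F≋G : V ⊚ F ≋ G
    V⊚F≋G = begin
      (⊖ G ⊛ τ) ⊚ F              ≈⟨ ⊚-⊛ F F₀≈0 (⊖ G) τ ⟩
      ((⊖ G) ⊚ F) ⊛ (τ ⊚ F)      ≈⟨ 𝕊.*-congʳ {τ ⊚ F} (⊚-⊖ F F₀≈0 G) ⟩
      ⊖ (G ⊚ F) ⊛ (τ ⊚ F)        ≈⟨ 𝕊.*-congʳ {τ ⊚ F} (𝕊.-‿cong G⊚F≋V) ⟩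
      ⊖ (⊖ G ⊛ τ) ⊛ (τ ⊚ F)      ≈⟨ 𝕊.*-congʳ {τ ⊚ F} (𝕊ᵖ.-‿distribˡ-* (⊖ G) τ) ⟩
      ⊖ (⊖ G) ⊛ τ ⊛ (τ ⊚ F)      ≈⟨ 𝕊.*-congʳ {τ ⊚ F} (𝕊.*-congʳ {τ} (𝕊ᵖ.-‿involutive G)) ⟩
      G ⊛ τ ⊛ (τ ⊚ F)            ≈⟨ ⊛-assoc G τ (τ ⊚ F) ⟩
      G ⊛ (τ ⊛ (τ ⊚ F))          ≈⟨ 𝕊.*-congˡ {G} τ⊛[τ⊚F]≋1 ⟩
      G ⊛ C 1#                   ≈⟨ 𝕊.*-identityʳ G ⟩
      G                          ∎

    F⊚F≋X : F ⊚ F ≋ X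
    F⊚F≋X = 𝕊.trans (G-solve (F ⊚ F) G F⊚F₀≈0 G⊚[F⊚F]≋G) Ḡ.inverseˡ
      where
      F⊚F₀≈0 : (F ⊚ F) 0 ≈ 0#
      F⊚F₀≈0 = trans (⊚-constant F F₀≈0 F) F₀≈0
      G⊚[F⊚F]≋G : G ⊚ (F ⊚ F) ≋ G
      G⊚[F⊚F]≋G = begin
        G ⊚ (F ⊚ F)   ≈⟨ ⊚-assoc F F₀≈0 F F₀≈0 G ⟨
        (G ⊚ F) ⊚ F   ≈⟨ ⊚-congˡ F G⊚F≋V ⟩
        V ⊚ F         ≈⟨ V⊚F≋G ⟩
        G             ∎

    F-involution : IsInvolution (g , F)
    F-involution = record
      { isRiordan  = record
        { g₀#0 = inverse⇒#0 ε²≈1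
        ; F₀≈0 = F₀≈0
        ; F₁#0 = inverse⇒#0 (square-linear F F₀≈0 F⊚F≋X)
        }
      ; square     = g⊛[g⊚F]≋1 , F⊚F≋X
      -- The identity has coefficient 0 in degree `r ≥ 1`, where `g` has `gᵣ`, apart from 0.
      ; nontrivial = λ (g≋1 , _) → #-irrefl (trans (g≋1 r) (C-positive 1# 1≤r)) gᵣ#0
      }

    module Uniqueness (K : Series) (involution : IsInvolution (g , K)) where
      open IsInvolution involution
      open IsRiordan isRiordan using () renaming (F₀≈0 to K₀≈0)

      -- `a` and `v` are the cofactors of `X` in `A` and `V`; their constant terms are the linear
      -- coefficients of the latter.
      A a v : Series
      A = G ⊚ K
      a = tail K ⊛ (ρ ⊚ K)
      v = ⊖ ρ ⊛ τ

      A≋X⊛a : A ≋ X ⊛ a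
      A≋X⊛a = begin
        (X ⊛ ρ) ⊚ K                  ≈⟨ ⊚-⊛ K K₀≈0 X ρ ⟩
        (X ⊚ K) ⊛ (ρ ⊚ K)            ≈⟨ 𝕊.*-congʳ {ρ ⊚ K} (𝕊.trans (X⊚ K K₀≈0) (X⊛-tail K K₀≈0)) ⟩
        X ⊛ tail K ⊛ (ρ ⊚ K)         ≈⟨ ⊛-assoc X (tail K) (ρ ⊚ K) ⟩
        X ⊛ a                        ∎

      V≋X⊛v : V ≋ X ⊛ v
      V≋X⊛v = begin
        ⊖ (X ⊛ ρ) ⊛ τ    ≈⟨ 𝕊.*-congʳ {τ} (𝕊ᵖ.-‿distribʳ-* X ρ) ⟩
        X ⊛ ⊖ ρ ⊛ τ      ≈⟨ ⊛-assoc X (⊖ ρ) τ ⟩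
        X ⊛ v            ∎

      gᵣA^r≋gᵣV^r : g r • (A ^ r) ≋ g r • (V ^ r)
      gᵣA^r≋gᵣV^r = 𝕊ᵖ.+-cancelˡ (C ε) (g r • (A ^ r)) (g r • (V ^ r)) (begin
        C ε ⊕ g r • (A ^ r)   ≈⟨ g⊚ K K₀≈0 ⟨
        g ⊚ K                 ≈⟨ 𝕊ᶠ.inverse-unique g (g ⊚ K) g⁻¹ (proj₁ square) g⊛g⁻¹≋1 ⟩
        g⁻¹                   ≈⟨ 𝕊.+-congˡ {C ε} V^r ⟨
        C ε ⊕ g r • (V ^ r)   ∎)

      a^r≋v^r : a ^ r ≋ v ^ r
      a^r≋v^r = X^-cancel r (a ^ r) (v ^ r) (begin
        X ^ r ⊛ a ^ r   ≈⟨ 𝕊^.^-distrib-* X a r ⟨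
        (X ⊛ a) ^ r     ≈⟨ ^-cong r A≋X⊛a ⟨
        A ^ r           ≈⟨ •-cancel gᵣ#0 (A ^ r) (V ^ r) gᵣA^r≋gᵣV^r ⟩
        V ^ r           ≈⟨ ^-cong r V≋X⊛v ⟩
        (X ⊛ v) ^ r     ≈⟨ 𝕊^.^-distrib-* X v r ⟩
        X ^ r ⊛ v ^ r   ∎)

      a₀≈K₁ : a 0 ≈ K 1
      a₀≈K₁ = trans (+-identityʳ _)
        (trans (*-congˡ (trans (⊚-constant K K₀≈0 ρ) ρ.constant)) (*-identityʳ (K 1)))

      v₀≈-1 : v 0 ≈ - 1#
      v₀≈-1 = trans (+-identityʳ _) (trans (*-cong (-‿cong ρ.constant) τ₀≈1) (*-identityʳ (- 1#)))

      -- As a₀² = v₀² = 1 and r is odd, a₀ = a₀ʳ = v₀ʳ = v₀.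
      a₀≈v₀ : a 0 ≈ v 0
      a₀≈v₀ = trans (sym (^-odd-constant a a₀²≈1 r r%2≡1))
        (trans (a^r≋v^r 0) (^-odd-constant v v₀²≈1 r r%2≡1))
        where
        a₀²≈1 : a 0 * a 0 ≈ 1#
        a₀²≈1 = trans (*-cong a₀≈K₁ a₀≈K₁) (square-linear K K₀≈0 (proj₂ square))
        v₀²≈1 : v 0 * v 0 ≈ 1#
        v₀²≈1 = CommutativeRingFacts.square-one fieldRing (inj₂ v₀≈-1)

      -v₀≈1 : (⊖ v) 0 ≈ 1#
      -v₀≈1 = trans (-‿cong v₀≈-1) (𝕂ᵖ.-‿involutive 1#)

      -- Both constant terms are -1, while uniqueness of roots needs 1. Negation repairs this, and
      -- oddness of r keeps the r-th powers equal.
      a≋v : a ≋ v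
      a≋v = 𝕊ᵖ.-‿injective (root-unique char0 r 1≤r (⊖ a) (⊖ v)
        (trans (-‿cong a₀≈v₀) -v₀≈1) -v₀≈1
        (begin
          (⊖ a) ^ r     ≈⟨ 𝕊ᶠ.-x^odd a r r%2≡1 ⟩
          ⊖ (a ^ r)     ≈⟨ 𝕊.-‿cong a^r≋v^r ⟩
          ⊖ (v ^ r)     ≈⟨ 𝕊ᶠ.-x^odd v r r%2≡1 ⟨
          (⊖ v) ^ r     ∎))

      K≋F : K ≋ F
      K≋F = G-solve K V K₀≈0 (begin
        A       ≈⟨ A≋X⊛a ⟩
        X ⊛ a   ≈⟨ 𝕊.*-congˡ {X} a≋v ⟩
        X ⊛ v   ≈⟨ V≋X⊛v ⟨
        V       ∎)

theorem3p3 :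
  ∀ {c ℓ₁ ℓ₂} (𝔽 : HeytingField c ℓ₁ ℓ₂) →
  let open HeytingField 𝔽
      open PowerSeries 𝔽
  in
  CharacteristicZero →
  (g : Series) (r : ℕ) →
  1 ≤ r → r % 2 ≡ 1 →
  (g 0 ≈ 1# ⊎ g 0 ≈ - 1#) →
  (∀ i → 1 ≤ i → i < r → g i ≈ 0#) →
  (gᵣ#0 : g r # 0#) →
  ∃ λ (ρ : Series) → IsRoot r (normalisedTail g r gᵣ#0) ρ ×
  ( let G = X ⊛ ρ in
    (g ≋ C (g 0) ⊕ g r • (G ^ r)) ×
    ∃! _≋_ (λ F → IsInvolution (g , F)) ×
    ∃ λ (Ḡ : Series) → IsCompositionalInverse G Ḡ ×
    ∃ λ (σ : Series) → IsRoot r (g 0 • g) σ ×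
    ∃ λ (τ : Series) → IsReciprocal σ τ ×
    (∀ F → IsInvolution (g , F) → F ≋ Ḡ ⊚ (⊖ G ⊛ τ))
  )
theorem3p3 𝔽 char0 g r 1≤r r%2≡1 g₀≈±1 gᵢ≈0 gᵣ#0 =
  ρ , proj₂ ρ-root , expansion ,
  -- Unique existence asks for `F ≋ K`, the reverse of the equation proved for a competitor.
  (F , F-involution , λ {K} involution m → HeytingField.sym 𝔽 (Uniqueness.K≋F K involution m)) ,
  Ḡ , proj₂ Ḡ-inverse , σ , proj₂ σ-root , τ , record { product = σ⊛τ≋1 } , Uniqueness.K≋F
  where
  open Involution.Construction 𝔽 char0 g r 1≤r r%2≡1
    (CommutativeRingFacts.square-one (SeriesRing.fieldRing 𝔽) g₀≈±1) gᵢ≈0 gᵣ#0
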